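{- Let $G$ be a graph with the canonical labeling and trivial multiplicity (the classical case), $E_G=\{e_1,\dots,e_m\}$, let $A=\{a_1,\dots,a_k\}$, let $\sigma$ be a multiplicity map of $G$ and $l:E_G\to A$ a labeling of $G$. Then: i) Permuting the names of the vertices of $G$ corresponds to a permutation of the columns of the matrix $\mathcal{A}_G$. ii) There exists a unique matrix $M_\sigma$ such that $\mathcal{A}_{(G,\sigma)}=M_\sigma\mathcal{A}_G$. It is the block matrix $M_\sigma=\begin{pmatrix}I_\sigma&0\\0&I_\sigma\end{pmatrix}$ with $I_\sigma=\operatorname{diag}(\sigma(e_1),\dots,\sigma(e_m))$. iii) There exists a unique matrix $R_l$ such that $\mathcal{A}_{(G,l,A)}=R_l\mathcal{A}_G$. It is a $2|A|\times2|E_G|$ matrix of the block form $R_l=\begin{pmatrix}B_l&0\\0&B_l\end{pmatrix}$, where $B_l=(b_{i,j})$ is the $|A|\times|E_G|$ matrix with $b_{i,j}=\delta_{a_i,l(e_j)}$. Now let $G=(G,l,A,\sigma)$, with $A=\{a_1,\dots,a_k\}$, and $H$ be labelled graphs with multiplicity. iii.bis) Let $l'$ be a labeling constructed from $l$ by assigning to all the elements of $l^{ -1}(a_k)$ one and the same element of $C=A\setminus\{a_k\}$ (and leaving all other labels unchanged). Then there exists a unique matrix $R_{l'}$ such that $\mathcal{A}_{(G,l',C,\sigma)}=R_{l'}\mathcal{A}_{(G,l,A,\sigma)}$. It is a $2|C|\times2|A|$ matrix of the block form $R_{l'}=\begin{pmatrix}B_{l'}&0\\0&B_{l'}\end{pmatrix}$,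 where $B_{l'}=(b_{i,j})$ is the $|C|\times|A|$ matrix with $b_{i,j}=\delta_{a_i,l'(a_j)}$; here $l'(a_j)$ denotes the new label in $C$ of the edges with $l$-label $a_j$. iv) $\mathcal{A}_{G\sqcup H}$ is made of the columns of $\mathcal{A}_G\#\mathcal{A}_H$, each repeated twice. v) $\mathcal{A}_{G\#_0H}=\mathcal{A}_G\#\mathcal{A}_H$.
   Context: Graphs are finite and simple with nonempty vertex set, $G=(V_G;E_G)$. Partitions. For a finite nonempty set $V$, $\Pi_V$ is the set of unordered pairs $A|B$ with $A\cup B=V$, $A\cap B=\emptyset$ (one of $A,B$ may be empty; $A|B=B|A$). $Cut_G(A|B)$ is the set of edges of $G$ with one endpoint in $A$ and the other in $B$. Labelled graphs with multiplicity. A labeling is a surjective map $l:E_G\to A$ onto a set $A$ of labels; the canonical labeling is $\{i,j\}\mapsto(i,j)$ (a bijection, so the label set is identified with $E_G$). A multiplicity map is a map $\sigma:E_G\to\mathbb{Z}\setminus\{0\}$; it is trivial if $\sigma\equiv1$. Then $(G,l,A,\sigma)$ is a labelled graph with multiplicity. When omitted, the labeling is canonical and the multiplicity trivial: $(G,\sigma)$ has canonical labeling and multiplicity $\sigma$; $(G,l,A)$ has labeling $l$ and trivial multiplicity. The matrix $\mathcal{A}$. The toric map $\phi_{(G,l,A,\sigma)}$ sends the variable $r_p$ ($p\in\Pi_{V_G}$) to the Laurent monomial $\prod_{e\in Cut_G(p)}s_{l(e)}^{\sigma(e)}\prod_{e\in E_G\setminus Cut_G(p)}t_{l(e)}^{\sigma(e)}$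 in variables $s_a,t_a$ ($a\in A$). $\mathcal{A}_{(G,l,A,\sigma)}$ is the integer matrix with $2|A|$ rows (indexed first by $s_a$, $a\in A$, then by $t_a$, $a\in A$, in a fixed order of $A$) and columns indexed by $\Pi_{V_G}$, the column of $p$ being the exponent vector of the image of $r_p$. In i), the edges of the graph with renamed vertices are matched with (and ordered as) the corresponding edges of $G$. Operations. The disjoint union is $(G,l,A,\sigma)\sqcup(H,i,B,\rho)=(G\sqcup H,(l,i),A\sqcup B,(\sigma,\rho))$, with disjoint label sets. The clique $0$-sum $G\#_0H$ is the labelled graph with multiplicity obtained from $G\sqcup H$ by identifying one vertex of $G$ with one vertex of $H$ (any choice), edges keeping their labels (in $A\sqcup B$) and multiplicities. The matrix $\mathcal{A}_G\#\mathcal{A}_H$ has rows indexed by the rows of $\mathcal{A}_G$ together with the rows of $\mathcal{A}_H$, and its columns are obtained by combining (stacking) a column of $\mathcal{A}_G$ with a column of $\mathcal{A}_H$ in all possible ways, one column for each pair in $\Pi_{V_G}\times\Pi_{V_H}$. The statements iv) and v) are understood up to the ordering of rows and columns.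
   Formalization: In ii), iii) and iii.bis) uniqueness is proved among block matrices (X 0; 0 Y) with arbitrary X, Y; among all matrices it fails, e.g. for the path with two edges, since s_1+t_1 and s_2+t_2 are the same constant row. -}

module Defs where

open import Algebra.Properties.CommutativeMonoid.Sum using (sum-cong-≗)
open import Data.Bool.Base using (Bool; not; if_then_else_)
open import Data.Empty using (⊥-elim) renaming (⊥ to Empty)
open import Data.Fin.Base using (Fin; inject₁; _↑ˡ_; _↑ʳ_; splitAt; punchOut)
open import Data.Fin.Permutation using (Permutation′; _⟨$⟩ʳ_; _⟨$⟩ˡ_; inverseˡ)
open import Data.Fin.Properties using (_≟_; ↑ˡ-injective; ↑ʳ-injective; splitAt-↑ˡ; splitAt-↑ʳ; splitAt⁻¹-↑ˡ; splitAt⁻¹-↑ʳ; punchOut-injective)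
open import Data.Fin.Relation.Unary.Top using (view; view-inject₁; ‵fromℕ; ‵inject₁)
open import Data.Fin.Subset using (Subset; _∈_; _∪_; _∩_; ⊤; ⊥)
open import Data.Fin.Subset.Properties using (_∈?_)
open import Data.Integer.Base using (ℤ; 0ℤ; 1ℤ; _+_; _*_)
open import Data.Integer.Properties using (+-0-commutativeMonoid)
open import Data.Nat.Base as ℕ using (ℕ; suc)
open import Data.Product.Base using (Σ; ∃; _×_; _,_; proj₁; proj₂; map)
open import Data.Sum.Base using (_⊎_; inj₁; inj₂; [_,_]′; swap)
open import Data.Sum.Properties using (≡-dec)
open import Function.Base using (_∘_; id)
open import Function.Bundles using (Inverse; _↔_; mk⇔)
open import Function.Definitions using (Injective; StrictlySurjective)
open import Level using (0ℓ)
open import Relation.Binary.Bundles using (Setoid)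
open import Relation.Binary.PropositionalEquality using (_≡_; _≢_; refl; sym; trans; cong; cong₂)
open import Relation.Nullary.Decidable using (does; yes; no; ¬?; _×-dec_; _⊎-dec_; does-⇔)
open import Relation.Unary using (Pred; Decidable)

open import Algebra.Properties.CommutativeMonoid.Sum +-0-commutativeMonoid public using (sum)

private
  variable
    k k′ h : ℕ

module _ {X : Set} where

  infix 4 _≈ᵤ_

  _≈ᵤ_ : X × X → X × X → Set
  (a , b) ≈ᵤ (c , d) = (a ≡ c × b ≡ d) ⊎ (a ≡ d × b ≡ c)

  ≈ᵤ-refl : ∀ {p} → p ≈ᵤ p
  ≈ᵤ-refl = inj₁ (refl , refl)

  ≈ᵤ-sym : ∀ {p q} → p ≈ᵤ q → q ≈ᵤ p
  ≈ᵤ-sym (inj₁ (refl , refl)) = inj₁ (refl , refl)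
  ≈ᵤ-sym (inj₂ (refl , refl)) = inj₂ (refl , refl)

  ≈ᵤ-trans : ∀ {p q r} → p ≈ᵤ q → q ≈ᵤ r → p ≈ᵤ r
  ≈ᵤ-trans (inj₁ (refl , refl)) q≈r = q≈r
  ≈ᵤ-trans (inj₂ (refl , refl)) (inj₁ (x , y)) = inj₂ (y , x)
  ≈ᵤ-trans (inj₂ (refl , refl)) (inj₂ (x , y)) = inj₁ (y , x)

≈ᵤ-map⁻ : ∀ {X Y : Set} {f : X → Y} → Injective _≡_ _≡_ f →
          ∀ {p q} → map f f p ≈ᵤ map f f q → p ≈ᵤ q
≈ᵤ-map⁻ inj (inj₁ (x , y)) = inj₁ (inj x , inj y)
≈ᵤ-map⁻ inj (inj₂ (x , y)) = inj₂ (inj x , inj y)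

-- The edge set comes enumerated as e₁,…,e_m.  The pair `ends e` is an
-- unordered pair: its orientation is immaterial.
record Graph : Set where
  field
    n : ℕ
    m : ℕ

  V : Set
  V = Fin (suc n)

  E : Set
  E = Fin m

  field
    ends     : E → V × V
    loopless : ∀ e → proj₁ (ends e) ≢ proj₂ (ends e)
    simple   : ∀ {e f} → ends e ≈ᵤ ends f → e ≡ f

open Graph public using (V; E)

record Partition (n : ℕ) : Set where
  field
    A B      : Subset n
    cover    : A ∪ B ≡ ⊤
    disjoint : A ∩ B ≡ ⊥

  parts : Subset n × Subset n
  parts = A , B

open Partition public using (parts)

Π-setoid : ℕ → Setoid 0ℓ 0ℓ
Π-setoid n = record
  { Carrier       = Partition n
  ; _≈_           = λ p q → parts p ≈ᵤ parts q
  ; isEquivalence = record { refl = ≈ᵤ-refl ; sym = ≈ᵤ-sym ; trans = ≈ᵤ-trans }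
  }

Π : Graph → Setoid 0ℓ 0ℓ
Π G = Π-setoid (suc (Graph.n G))

∣Π_∣ : Graph → Set
∣Π G ∣ = Setoid.Carrier (Π G)

module _ (G : Graph) where
  open Graph G using (ends)

  Cut : ∣Π G ∣ → Pred (E G) 0ℓ
  Cut p e = let (i , j) = ends e ; (A , B) = parts p in
            (i ∈ A × j ∈ B) ⊎ (i ∈ B × j ∈ A)

  cut? : ∀ p → Decidable (Cut p)
  cut? p e = let (i , j) = ends e ; (A , B) = parts p in
             ((i ∈? A) ×-dec (j ∈? B)) ⊎-dec ((i ∈? B) ×-dec (j ∈? A))

-- The label set A = {a₁,…,a_k} is Fin k.
record Labeling (G : Graph) (k : ℕ) : Set where
  field
    label      : E G → Fin k
    surjective : StrictlySurjective _≡_ label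

record Multiplicity (G : Graph) : Set where
  field
    mult    : E G → ℤ
    nonzero : ∀ e → mult e ≢ 0ℤ

record LabelledGraph (k : ℕ) : Set where
  constructor ⟨_,_,_⟩
  field
    graph        : Graph
    labeling     : Labeling graph k
    multiplicity : Multiplicity graph

  open Graph graph public
  open Labeling labeling public
  open Multiplicity multiplicity public

open LabelledGraph public using (graph; labeling; multiplicity)

canonical : (G : Graph) → Labeling G (Graph.m G)
canonical G = record { label = id ; surjective = λ e → e , refl }

trivial : (G : Graph) → Multiplicity G
trivial G = record { mult = λ _ → 1ℤ ; nonzero = λ _ () }

classical : (G : Graph) → LabelledGraph (Graph.m G)
classical G = ⟨ G , canonical G , trivial G ⟩

-- The variables s_a and t_a, in this order.
Var : ℕ → Set
Var k = Fin k ⊎ Fin k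

pattern s a = inj₁ a
pattern t a = inj₂ a

-- A Laurent monomial is given by its exponent vector.
Monomial : ℕ → Set
Monomial k = Var k → ℤ

_·_ : Monomial k → Monomial k → Monomial k
(f · g) x = f x + g x

_^_ : Var k → ℤ → Monomial k
(x ^ z) y = if does (≡-dec _≟_ _≟_ x y) then z else 0ℤ

∏ : {P : Pred (Fin k′) 0ℓ} → Decidable P → (Fin k′ → Monomial k) → Monomial k
∏ P? f x = sum (λ e → if does (P? e) then f e x else 0ℤ)

φ : (G : LabelledGraph k) → ∣Π graph G ∣ → Monomial k
φ G p = ∏ (cut? (graph G) p)        (λ e → s (label e) ^ mult e)
      · ∏ (¬? ∘ cut? (graph G) p)   (λ e → t (label e) ^ mult e)
  where open LabelledGraph G using (label; mult)

Matrix : Set → Set → Set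
Matrix R C = R → C → ℤ

infix 4 _≐_

_≐_ : ∀ {R C} → Matrix R C → Matrix R C → Set
X ≐ Y = ∀ r c → X r c ≡ Y r c

infixl 7 _⊗_

_⊗_ : ∀ {R C} → Matrix R (Var k) → Matrix (Var k) C → Matrix R C
(M ⊗ X) r c = sum (λ a → M r (s a) * X (s a) c) + sum (λ a → M r (t a) * X (t a) c)

𝒜 : (G : LabelledGraph k) → Matrix (Var k) ∣Π graph G ∣
𝒜 G x p = φ G p x

-- 𝒜 is well defined on unordered partitions.
𝒜-cong : (G : LabelledGraph k) → ∀ x {p q} → Setoid._≈_ (Π (graph G)) p q →
         𝒜 G x p ≡ 𝒜 G x q
𝒜-cong G x {p} {q} p≈q =
  cong₂ _+_ (∏-cong (cut? (graph G) p) (cut? (graph G) q)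
                    (λ e → s (label e) ^ mult e) cut≡)
            (∏-cong (¬? ∘ cut? (graph G) p) (¬? ∘ cut? (graph G) q)
                    (λ e → t (label e) ^ mult e) (λ e → cong not (cut≡ e)))
  where
  open LabelledGraph G using (label; mult)

  ∏-cong : {P Q : Pred (E (graph G)) 0ℓ} (P? : Decidable P) (Q? : Decidable Q)
           (f : E (graph G) → Monomial _) → (∀ e → does (P? e) ≡ does (Q? e)) →
           ∏ P? f x ≡ ∏ Q? f x
  ∏-cong P? Q? f P≡Q = sum-cong-≗ +-0-commutativeMonoid
    (λ e → cong (if_then f e x else 0ℤ) (P≡Q e))

  transport : ∀ {p q} → Setoid._≈_ (Π (graph G)) p q →
              ∀ e → Cut (graph G) p e → Cut (graph G) q e
  transport {record {}} {record {}} (inj₁ (refl , refl)) e c = c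
  transport {record {}} {record {}} (inj₂ (refl , refl)) e c = swap c

  cut≡ : ∀ e → does (cut? (graph G) p e) ≡ does (cut? (graph G) q e)
  cut≡ e = does-⇔ (mk⇔ (transport {p} {q} p≈q e) (transport {q} {p} (≈ᵤ-sym p≈q) e))
                  (cut? (graph G) p e) (cut? (graph G) q e)

δ : Fin k → Fin k → ℤ
δ i j = if does (i ≟ j) then 1ℤ else 0ℤ

diag : (Fin k′ → ℤ) → Matrix (Fin k′) (Fin k′)
diag d i j = d i * δ i j

indicator : (Fin k′ → Fin k) → Matrix (Fin k) (Fin k′)
indicator f i j = δ i (f j)

block : Matrix (Fin k) (Fin k′) → Matrix (Fin k) (Fin k′) → Matrix (Var k) (Var k′)
block X Y (s i) (s j) = X i j
block X Y (s i) (t j) = 0ℤ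
block X Y (t i) (s j) = 0ℤ
block X Y (t i) (t j) = Y i j

BlockDiagonal : Matrix (Var k) (Var k′) → Set
BlockDiagonal M = ∃ λ X → ∃ λ Y → M ≐ block X Y

-- M is the unique matrix of the block form (X 0 ; 0 Y) with T = M S.
-- The block form cannot be dropped: for every label a the rows s_a and t_a of
-- 𝒜 add up to a constant row, so with two or more labels the rows of 𝒜 are
-- linearly dependent and T = M S alone does not determine M.  The blocks X and
-- Y of a competitor need not agree.
IsUniqueFactor : ∀ {C} → Matrix (Var k) C → Matrix (Var k′) C → Matrix (Var k) (Var k′) → Set
IsUniqueFactor T S M =
  (BlockDiagonal M × T ≐ M ⊗ S) × (∀ N → BlockDiagonal N → T ≐ N ⊗ S → N ≐ M)

SameUpToOrder : (R R′ : Set) (C C′ : Setoid 0ℓ 0ℓ) →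
                Matrix R (Setoid.Carrier C) → Matrix R′ (Setoid.Carrier C′) → Set
SameUpToOrder R R′ C C′ X Y =
  Σ (R ↔ R′) λ ρ → Σ (Inverse C C′) λ τ →
  ∀ r c → X r c ≡ Y (Inverse.to ρ r) (Inverse.to τ c)

infixr 6 _#_

_#_ : ∀ {R R′ C C′} → Matrix R C → Matrix R′ C′ → Matrix (R ⊎ R′) (C × C′)
(X # Y) r (c , c′) = [ (λ i → X i c) , (λ j → Y j c′) ]′ r

twice : ∀ {R C} → Matrix R C → Matrix R (C × Bool)
twice X r (c , _) = X r c

rename : (G : Graph) → Permutation′ (suc (Graph.n G)) → Graph
rename G π = record
  { n        = Graph.n G
  ; m        = Graph.m G
  ; ends     = map (π ⟨$⟩ʳ_) (π ⟨$⟩ʳ_) ∘ ends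
  ; loopless = λ e eq → loopless e (inj eq)
  ; simple   = λ eq → simple (≈ᵤ-map⁻ inj eq)
  }
  where
  open Graph G using (ends; loopless; simple)
  inj : Injective _≡_ _≡_ (π ⟨$⟩ʳ_)
  inj eq = trans (sym (inverseˡ π)) (trans (cong (π ⟨$⟩ˡ_) eq) (inverseˡ π))

-- The labels {a₁,…,a_k} of C = A ∖ {a_{k+1}} sit in A through inject₁.
merge : Fin k → Fin (suc k) → Fin k
merge c a with view a
... | ‵fromℕ     = c
... | ‵inject₁ b = b

mergeLast : ∀ {G} → Fin k → Labeling G (suc k) → Labeling G k
mergeLast {k} c l = record
  { label      = merge c ∘ label
  ; surjective = λ b → let (e , eq) = surjective (inject₁ b) in
                       e , trans (cong (merge c) eq) (merge-inject₁ b)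
  }
  where
  open Labeling l
  merge-inject₁ : ∀ b → merge c (inject₁ b) ≡ b
  merge-inject₁ b rewrite view-inject₁ b = refl

-- The union of G and H, placed on a common vertex set along injections f and g
-- whose images meet in at most one vertex.
module Union (G : LabelledGraph k) (H : LabelledGraph h) {N : ℕ}
             (f : V (graph G) → Fin (suc N)) (g : V (graph H) → Fin (suc N))
             (f-inj : Injective _≡_ _≡_ f) (g-inj : Injective _≡_ _≡_ g)
             (meet : ∀ {x x′ y y′} → f x ≡ g y → f x′ ≡ g y′ → x ≡ x′) where

  private
    module G = LabelledGraph G
    module H = LabelledGraph H

  both : {X : Set} → (E (graph G) → X) → (E (graph H) → X) → Fin (G.m ℕ.+ H.m) → X
  both a b e = [ a , b ]′ (splitAt G.m e)

  fends : E (graph G) → Fin (suc N) × Fin (suc N)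
  fends = map f f ∘ G.ends

  gends : E (graph H) → Fin (suc N) × Fin (suc N)
  gends = map g g ∘ H.ends

  apart : ∀ e e′ → fends e ≈ᵤ gends e′ → Empty
  apart e e′ (inj₁ (x , y)) = G.loopless e (meet x y)
  apart e e′ (inj₂ (x , y)) = G.loopless e (meet x y)

  loopless′ : ∀ e → proj₁ (both fends gends e) ≢ proj₂ (both fends gends e)
  loopless′ e eq with splitAt G.m e
  ... | inj₁ i = G.loopless i (f-inj eq)
  ... | inj₂ j = H.loopless j (g-inj eq)

  simple′ : ∀ {e e′} → both fends gends e ≈ᵤ both fends gends e′ → e ≡ e′
  simple′ {e} {e′} eq with splitAt G.m e in p | splitAt G.m e′ in q
  ... | inj₁ i | inj₁ i′ = trans (sym (splitAt⁻¹-↑ˡ p))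
        (trans (cong (_↑ˡ H.m) (G.simple (≈ᵤ-map⁻ f-inj eq))) (splitAt⁻¹-↑ˡ q))
  ... | inj₁ i | inj₂ j′ = ⊥-elim (apart i j′ eq)
  ... | inj₂ j | inj₁ i′ = ⊥-elim (apart i′ j (≈ᵤ-sym eq))
  ... | inj₂ j | inj₂ j′ = trans (sym (splitAt⁻¹-↑ʳ p))
        (trans (cong (G.m ↑ʳ_) (H.simple (≈ᵤ-map⁻ g-inj eq))) (splitAt⁻¹-↑ʳ q))

  surjective′ : StrictlySurjective _≡_ (both ((_↑ˡ h) ∘ G.label) ((k ↑ʳ_) ∘ H.label))
  surjective′ c with splitAt k c in p
  ... | inj₁ a = let (e , eq) = G.surjective a in e ↑ˡ H.m ,
        trans (cong [ _ , _ ]′ (splitAt-↑ˡ G.m e H.m))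
              (trans (cong (_↑ˡ h) eq) (splitAt⁻¹-↑ˡ p))
  ... | inj₂ b = let (e , eq) = H.surjective b in G.m ↑ʳ e ,
        trans (cong [ _ , _ ]′ (splitAt-↑ʳ G.m H.m e))
              (trans (cong (k ↑ʳ_) eq) (splitAt⁻¹-↑ʳ p))

  nonzero′ : ∀ e → both G.mult H.mult e ≢ 0ℤ
  nonzero′ e with splitAt G.m e
  ... | inj₁ i = G.nonzero i
  ... | inj₂ j = H.nonzero j

  union : LabelledGraph (k ℕ.+ h)
  union = record
    { graph = record
      { n        = N
      ; m        = G.m ℕ.+ H.m
      ; ends     = both fends gends
      ; loopless = loopless′
      ; simple   = simple′
      }
    ; labeling = record
      { label      = both ((_↑ˡ h) ∘ G.label) ((k ↑ʳ_) ∘ H.label)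
      ; surjective = surjective′
      }
    ; multiplicity = record
      { mult    = both G.mult H.mult
      ; nonzero = nonzero′
      }
    }

↑ˡ≢↑ʳ : ∀ {a b} (i : Fin a) (j : Fin b) → i ↑ˡ b ≢ a ↑ʳ j
↑ˡ≢↑ʳ {a} {b} i j eq
  with () ← trans (sym (splitAt-↑ˡ a i b)) (trans (cong (splitAt a) eq) (splitAt-↑ʳ a b j))

_⊔_ : LabelledGraph k → LabelledGraph h → LabelledGraph (k ℕ.+ h)
G ⊔ H = Union.union G H
  (_↑ˡ suc H.n) (suc G.n ↑ʳ_)
  (λ {i} {j} → ↑ˡ-injective (suc H.n) i j) (λ {i} {j} → ↑ʳ-injective (suc G.n) i j)
  (λ {x} {_} {y} eq _ → ⊥-elim (↑ˡ≢↑ʳ x y eq))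
  where
  module G = LabelledGraph G
  module H = LabelledGraph H

-- Identifies the vertex v of H with the vertex u of G: the vertices of the
-- sum are those of G followed by those of H other than v.
module ZeroSum (G : LabelledGraph k) (H : LabelledGraph h)
               (u : V (graph G)) (v : V (graph H)) where

  private
    module G = LabelledGraph G
    module H = LabelledGraph H

  fromG : V (graph G) → Fin (suc (G.n ℕ.+ H.n))
  fromG = _↑ˡ H.n

  fromH : V (graph H) → Fin (suc (G.n ℕ.+ H.n))
  fromH w with v ≟ w
  ... | yes _  = fromG u
  ... | no v≢w = suc G.n ↑ʳ punchOut v≢w

  fromG-injective : Injective _≡_ _≡_ fromG
  fromG-injective {i} {j} = ↑ˡ-injective H.n i j

  fromH-injective : Injective _≡_ _≡_ fromH
  fromH-injective {w} {w′} eq with v ≟ w | v ≟ w′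
  ... | yes refl | yes refl = refl
  ... | yes _    | no q     = ⊥-elim (↑ˡ≢↑ʳ u (punchOut q) eq)
  ... | no p     | yes _    = ⊥-elim (↑ˡ≢↑ʳ u (punchOut p) (sym eq))
  ... | no p     | no q     =
        punchOut-injective p q (↑ʳ-injective (suc G.n) (punchOut p) (punchOut q) eq)

  common : ∀ x y → fromG x ≡ fromH y → x ≡ u
  common x y eq with v ≟ y
  ... | yes _ = fromG-injective eq
  ... | no p  = ⊥-elim (↑ˡ≢↑ʳ x (punchOut p) eq)

  zeroSum : LabelledGraph (k ℕ.+ h)
  zeroSum = Union.union G H fromG fromH fromG-injective fromH-injective
    (λ {x} {x′} {y} {y′} eq eq′ → trans (common x y eq) (sym (common x′ y′ eq′)))

open ZeroSum public using (zeroSum)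

{-# OPTIONS --safe #-}
module Submission where

-- A partition is a 2-colouring of the vertices up to a global flip, and it cuts
-- the edges whose ends differ in colour.  Restricting colourings along the two
-- halves of a union gives iv) and v): the only datum lost is the relative colour
-- of the halves, a free bit for a disjoint union and forced for a 0-sum.
-- For the uniqueness in ii), iii), iii.bis), take an edge e = uv and write c(p)
-- for the indicator vector of a cut: c(u) + c(v) − c(uv) − c(∅) = 2·1ₑ, and −2·1ₑ
-- for the complements.  So the s-rows, and likewise the t-rows, are linearly
-- independent.

open import Algebra.Bundles using (CommutativeRing)
open import Data.Bool.Base using (Bool; true; false; not; _∧_; _∨_; _xor_; if_then_else_)
open import Data.Bool.Properties using (if-eta; not-involutive; xor-same)
open import Data.Bool.Solver using (module xor-∧-Solver)
open import Data.Fin.Base using (Fin; zero; suc; splitAt; _↑ˡ_; _↑ʳ_; punchIn; punchOut)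
open import Data.Fin.Permutation using (Permutation′; _⟨$⟩ʳ_; _⟨$⟩ˡ_; inverseˡ; inverseʳ)
open import Data.Fin.Properties using (_≟_; punchInᵢ≢i; punchIn-punchOut; punchOut-punchIn; ↑ˡ-injective; ↑ʳ-injective; splitAt-↑ˡ; splitAt-↑ʳ; splitAt⁻¹-↑ˡ; splitAt⁻¹-↑ʳ)
open import Data.Fin.Subset using (Subset)
open import Data.Fin.Subset.Properties using (_∈?_)
open import Data.Integer.Base as ℤ using (ℤ; 0ℤ; 1ℤ)
open import Data.Integer.Properties as ℤ using ()
open import Data.Integer.Tactic.RingSolver using (solve-∀)
open import Data.Nat.Base using (ℕ; zero; suc; _+_)
open import Data.Product.Base as Product using (Σ; ∃; _×_; _,_; proj₁; proj₂)
open import Data.Product.Relation.Binary.Pointwise.NonDependent using (_×ₛ_)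
open import Data.Sum.Base as Sum using (_⊎_; inj₁; inj₂; [_,_]′)
open import Data.Vec.Base using (_∷_; lookup; tabulate)
open import Data.Vec.Properties using (lookup-zipWith; lookup-replicate; lookup∘tabulate; tabulate∘lookup; tabulate-cong)
open import Function.Base using (_∘_)
open import Function.Bundles using (Inverse; _↔_; mk⇔; mk↔ₛ′)
open import Function.Definitions using (Injective)
open import Level using (0ℓ)
open import Relation.Binary.Bundles using (Setoid)
open import Relation.Binary.PropositionalEquality using (_≡_; _≢_; _≗_; refl; sym; trans; cong; cong₂; subst; setoid; module ≡-Reasoning)
open import Relation.Nullary.Decidable using (does; yes; no; dec-true; dec-false; does-⇔)
open import Relation.Nullary.Negation using (contradiction)
open import Defs

open import Algebra.Properties.Group (CommutativeRing.+-group ℤ.+-*-commutativeRing) using () renaming (∙-cancelˡ to +-cancelˡ)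
open import Algebra.Properties.Semiring.Sum (CommutativeRing.semiring ℤ.+-*-commutativeRing) using (sum-cong-≗; sum-replicate-zero; sum-remove; ∑-comm; ∑-distrib-+; *-distribˡ-sum)

open ≡-Reasoning

private
  variable
    k k′ h n : ℕ

-- Integer sums

sum-zero : (f : Fin n → ℤ) → (∀ i → f i ≡ 0ℤ) → sum f ≡ 0ℤ
sum-zero {n} f f≡0 = trans (sum-cong-≗ f≡0) (sum-replicate-zero n)

sum-single : (f : Fin n → ℤ) (i : Fin n) → (∀ j → i ≢ j → f j ≡ 0ℤ) → sum f ≡ f i
sum-single {suc n} f i off = begin
  sum f                             ≡⟨ sum-remove {i = i} f ⟩
  f i ℤ.+ sum (f ∘ punchIn i)       ≡⟨ cong (λ z → f i ℤ.+ z) (sum-zero (f ∘ punchIn i) (λ j → off _ (punchInᵢ≢i i j ∘ sym))) ⟩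
  f i ℤ.+ 0ℤ                        ≡⟨ ℤ.+-identityʳ _ ⟩
  f i                               ∎

sum-++ : ∀ m {n} (f : Fin (m + n) → ℤ) →
         sum f ≡ sum (f ∘ (_↑ˡ n)) ℤ.+ sum (f ∘ (m ↑ʳ_))
sum-++ zero    f = sym (ℤ.+-identityˡ _)
sum-++ (suc m) f = trans (cong (λ z → f zero ℤ.+ z) (sum-++ m (f ∘ suc))) (sym (ℤ.+-assoc (f zero) _ _))

-- The value `z` stays free because two selections occur: of the label of an edge, with its
-- multiplicity, and of a single edge, with 1.
if-select : (f : Fin n → ℤ) (i : Fin n) (z : ℤ) →
            sum (λ j → f j ℤ.* (if does (i ≟ j) then z else 0ℤ)) ≡ f i ℤ.* z
if-select f i z = trans
  (sum-single _ i (λ j i≢j → trans (cong (λ b → f j ℤ.* (if b then z else 0ℤ)) (dec-false (i ≟ j) i≢j)) (ℤ.*-zeroʳ (f j))))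
  (cong (λ b → f i ℤ.* (if b then z else 0ℤ)) (dec-true (i ≟ i) refl))

-- Partitions as 2-colourings

Colouring : ℕ → Set
Colouring n = Fin n → Bool

-- Only `A` is recorded, since `B` is its complement. Exchanging `A` and `B` flips all colours,
-- which `_∼_` absorbs.
side : Partition n → Colouring n
side p = lookup (Partition.A p)

does-∈? : (i : Fin n) (A : Subset n) → does (i ∈? A) ≡ lookup A i
does-∈? zero    (true  ∷ A) = refl
does-∈? zero    (false ∷ A) = refl
does-∈? (suc i) (_     ∷ A) = does-∈? i A

∨∧-complement : ∀ {a b} → a ∨ b ≡ true → a ∧ b ≡ false → b ≡ not a
∨∧-complement {true}  _ eq = eq
∨∧-complement {false} eq _ = eq

lookup-B : (p : Partition n) → lookup (Partition.B p) ≗ not ∘ side p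
lookup-B p i = ∨∧-complement
  (trans (sym (lookup-zipWith _∨_ i A B)) (trans (cong (λ C → lookup C i) cover) (lookup-replicate i true)))
  (trans (sym (lookup-zipWith _∧_ i A B)) (trans (cong (λ C → lookup C i) disjoint) (lookup-replicate i false)))
  where open Partition p

lookup-ext : {A B : Subset n} → lookup A ≗ lookup B → A ≡ B
lookup-ext {A = A} {B} eq = trans (sym (tabulate∘lookup A)) (trans (tabulate-cong eq) (tabulate∘lookup B))

partition : Colouring n → Partition n
partition c = record
  { A        = tabulate c
  ; B        = tabulate (not ∘ c)
  ; cover    = lookup-ext λ i → trans (lookup-zipWith _∨_ i (tabulate c) (tabulate (not ∘ c)))
      (trans (cong₂ _∨_ (lookup∘tabulate c i) (lookup∘tabulate (not ∘ c) i))
             (trans (∨-not (c i)) (sym (lookup-replicate i true))))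
  ; disjoint = lookup-ext λ i → trans (lookup-zipWith _∧_ i (tabulate c) (tabulate (not ∘ c)))
      (trans (cong₂ _∧_ (lookup∘tabulate c i) (lookup∘tabulate (not ∘ c) i))
             (trans (∧-not (c i)) (sym (lookup-replicate i false))))
  }
  where
  ∨-not : ∀ a → a ∨ not a ≡ true
  ∨-not true  = refl
  ∨-not false = refl
  ∧-not : ∀ a → a ∧ not a ≡ false
  ∧-not true  = refl
  ∧-not false = refl

side-partition : (c : Colouring n) → side (partition c) ≗ c
side-partition = lookup∘tabulate

infix 4 _∼_

_∼_ : Colouring n → Colouring n → Set
c ∼ d = ∃ λ b → ∀ i → c i ≡ b xor d i

side-cong : {p q : Partition n} → parts p ≈ᵤ parts q → side p ∼ side q
side-cong         (inj₁ (A≡A , _)) = false , λ i → cong (λ C → lookup C i) A≡A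
side-cong {q = q} (inj₂ (A≡B , _)) = true  , λ i → trans (cong (λ C → lookup C i) A≡B) (lookup-B q i)

-- With `side-cong`, unordered partitions become colourings modulo a global flip.
side-injective : {p q : Partition n} → side p ∼ side q → parts p ≈ᵤ parts q
side-injective {p = p} {q} (false , eq) = inj₁
  ( lookup-ext eq
  , lookup-ext (λ i → trans (lookup-B p i) (trans (cong not (eq i)) (sym (lookup-B q i)))))
side-injective {p = p} {q} (true , eq) = inj₂
  ( lookup-ext (λ i → trans (eq i) (sym (lookup-B q i)))
  , lookup-ext (λ i → trans (lookup-B p i) (trans (cong not (eq i)) (not-involutive _))))

-- The rows of 𝒜

χ : Bool → ℤ
χ b = if b then 1ℤ else 0ℤ

cutting : (G : Graph) → Colouring (suc (Graph.n G)) → E G → Bool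
cutting G c e = c (proj₁ (Graph.ends G e)) xor c (proj₂ (Graph.ends G e))

does-cut? : (G : Graph) (p : ∣Π G ∣) → does ∘ cut? G p ≗ cutting G (side p)
does-cut? G p e
  rewrite does-∈? (proj₁ (Graph.ends G e)) (Partition.A p)
        | does-∈? (proj₁ (Graph.ends G e)) (Partition.B p)
        | does-∈? (proj₂ (Graph.ends G e)) (Partition.A p)
        | does-∈? (proj₂ (Graph.ends G e)) (Partition.B p)
        | lookup-B p (proj₁ (Graph.ends G e))
        | lookup-B p (proj₂ (Graph.ends G e))
  = bool (side p (proj₁ (Graph.ends G e))) (side p (proj₂ (Graph.ends G e)))
  where
  bool : ∀ a b → (a ∧ not b) ∨ (not a ∧ b) ≡ a xor b
  bool true  true  = refl
  bool true  false = refl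
  bool false _     = refl

-- The `y`-weight of the cut for `b = false` and of its complement for `b = true`. Arbitrary weights
-- `y` cover both the rows and their linear combinations.
edgeSum : (G : Graph) → Bool → (E G → ℤ) → Colouring (suc (Graph.n G)) → ℤ
edgeSum G b y c = sum (λ e → χ (b xor cutting G c e) ℤ.* y e)

edgeSum-cong : (G : Graph) (b : Bool) (y : E G → ℤ) {c d : Colouring (suc (Graph.n G))} →
               c ≗ d → edgeSum G b y c ≡ edgeSum G b y d
edgeSum-cong G b y eq = sum-cong-≗ λ e → cong (λ z → χ (b xor z) ℤ.* y e) (cong₂ _xor_ (eq _) (eq _))

-- `row false` and `row true` are the rows s_a and t_a: the edges counted by
-- the latter are the non-cut edges, and `true xor_` is negation.
row : Bool → Fin k → Var k
row false a = s a
row true  a = t a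

coeff : (G : LabelledGraph k) → Fin k → E (graph G) → ℤ
coeff G a e = if does (LabelledGraph.label G e ≟ a) then LabelledGraph.mult G e else 0ℤ

rowSum : (G : LabelledGraph k) → Bool → Fin k → Colouring (suc (LabelledGraph.n G)) → ℤ
rowSum G b a = edgeSum (graph G) b (coeff G a)

if-χ : ∀ b z → (if b then z else 0ℤ) ≡ χ b ℤ.* z
if-χ true  z = sym (ℤ.*-identityˡ z)
if-χ false z = sym (ℤ.*-zeroˡ z)

𝒜-row : (G : LabelledGraph k) (b : Bool) (a : Fin k) (p : ∣Π graph G ∣) →
        𝒜 G (row b a) p ≡ rowSum G b a (side p)
𝒜-row G false a p = trans
  (cong₂ ℤ._+_
    (sum-cong-≗ λ e → trans (if-χ (does (cut? (graph G) p e)) _) (cong (λ b → χ b ℤ.* coeff G a e) (does-cut? (graph G) p e)))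
    -- A power of a `t`-variable has exponent 0 at `s a`, so both branches of the conditional are 0.
    (sum-zero _ λ e → if-eta (not (does (cut? (graph G) p e)))))
  (ℤ.+-identityʳ _)
𝒜-row G true a p = trans
  (cong₂ ℤ._+_
    (sum-zero _ λ e → if-eta (does (cut? (graph G) p e)))
    (sum-cong-≗ λ e → trans (if-χ (not (does (cut? (graph G) p e))) _) (cong (λ b → χ (not b) ℤ.* coeff G a e) (does-cut? (graph G) p e))))
  (ℤ.+-identityˡ _)

-- Unique factorisations

-- After exchanging the two sums, each edge contributes only through its own label. Hence
-- independence of rows reduces to injectivity of `edgeSum` in its weights.
combination-of-rows : (G : LabelledGraph k) (b : Bool) (x : Fin k → ℤ) (p : ∣Π graph G ∣) →
  let open LabelledGraph G using (label; mult) in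
  sum (λ a → x a ℤ.* 𝒜 G (row b a) p) ≡ edgeSum (graph G) b (λ e → x (label e) ℤ.* mult e) (side p)
combination-of-rows G b x p = begin
  sum (λ a → x a ℤ.* 𝒜 G (row b a) p)
    ≡⟨ sum-cong-≗ (λ a → trans (cong (x a ℤ.*_) (𝒜-row G b a p)) (*-distribˡ-sum (x a) (λ e → χ′ e ℤ.* coeff G a e))) ⟩
  sum (λ a → sum (λ e → x a ℤ.* (χ′ e ℤ.* coeff G a e)))
    ≡⟨ ∑-comm (λ a e → x a ℤ.* (χ′ e ℤ.* coeff G a e)) ⟩
  sum (λ e → sum (λ a → x a ℤ.* (χ′ e ℤ.* coeff G a e)))
    ≡⟨ sum-cong-≗ (λ e → sum-cong-≗ (λ a → exchange (x a) (χ′ e) (coeff G a e))) ⟩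
  sum (λ e → sum (λ a → χ′ e ℤ.* (x a ℤ.* coeff G a e)))
    ≡⟨ sum-cong-≗ (λ e → sym (*-distribˡ-sum (χ′ e) (λ a → x a ℤ.* coeff G a e))) ⟩
  sum (λ e → χ′ e ℤ.* sum (λ a → x a ℤ.* coeff G a e))
    ≡⟨ sum-cong-≗ (λ e → cong (χ′ e ℤ.*_) (if-select x (label e) (mult e))) ⟩
  edgeSum (graph G) b (λ e → x (label e) ℤ.* mult e) (side p) ∎
  where
  open LabelledGraph G using (label; mult)
  χ′ : E (graph G) → ℤ
  χ′ e = χ (b xor cutting (graph G) (side p) e)
  exchange : ∀ x y z → x ℤ.* (y ℤ.* z) ≡ y ℤ.* (x ℤ.* z)
  exchange = solve-∀

-- Linear independence of the rows

star : Fin n → Colouring n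
star u i = does (i ≟ u)

module _ (G : Graph) where
  open Graph G using (ends; loopless; simple)

  -- An edge lies in the cut of a single vertex exactly when it is incident to it. Incidence with
  -- both `u` and `v` determines the edge in a simple graph.
  cutting-star-∧ : ∀ e e′ → let (u , v) = ends e in
                   cutting G (star u) e′ ∧ cutting G (star v) e′ ≡ does (e ≟ e′)
  cutting-star-∧ e e′ with e ≟ e′
  ... | yes refl
    rewrite dec-true (proj₁ (ends e) ≟ proj₁ (ends e)) refl
          | dec-true (proj₂ (ends e) ≟ proj₂ (ends e)) refl
          | dec-false (proj₁ (ends e) ≟ proj₂ (ends e)) (loopless e)
          | dec-false (proj₂ (ends e) ≟ proj₁ (ends e)) (loopless e ∘ sym) = refl
  ... | no e≢e′
    with proj₁ (ends e′) ≟ proj₁ (ends e) | proj₂ (ends e′) ≟ proj₁ (ends e)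
       | proj₁ (ends e′) ≟ proj₂ (ends e) | proj₂ (ends e′) ≟ proj₂ (ends e)
  ... | yes _  | yes _  | _      | _      = refl
  ... | no _   | no _   | _      | _      = refl
  ... | yes _  | no _   | yes _  | yes _  = refl
  -- With ends `u` and `v`, in either order, simplicity gives `e ≡ e′`. An end equal to both `u` and
  -- `v` would make `e` a loop.
  ... | yes p  | no _   | _      | yes q  = contradiction (simple (inj₁ (sym p , sym q))) e≢e′
  ... | yes p  | no _   | yes q  | no _   = contradiction (trans (sym p) q) (loopless e)
  ... | yes _  | no _   | no _   | no _   = refl
  ... | no _   | yes _  | yes _  | yes _  = refl
  ... | no _   | yes p  | yes q  | no _   = contradiction (simple (inj₂ (sym p , sym q))) e≢e′
  ... | no _   | yes p  | no _   | yes q  = contradiction (trans (sym p) q) (loopless e)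
  ... | no _   | yes _  | no _   | no _   = refl

±2 : Bool → ℤ
±2 b = if b then ℤ.- (ℤ.+ 2) else ℤ.+ 2

-- For `b = false` this is inclusion-exclusion, x + y = (x xor y) + 2(x ∧ y), and `χ (b xor false)`
-- is 0. For `b = true` every indicator χ becomes 1 - χ: the sign of 2 changes and
-- `χ (b xor false)`, now 1, balances the constants.
χ-xor : ∀ b x y → χ (b xor x) ℤ.+ χ (b xor y) ≡ (χ (b xor (x xor y)) ℤ.+ χ (b xor false)) ℤ.+ ±2 b ℤ.* χ (x ∧ y)
χ-xor false false false = refl
χ-xor false false true  = refl
χ-xor false true  false = refl
χ-xor false true  true  = refl
χ-xor true  false false = refl
χ-xor true  false true  = refl
χ-xor true  true  false = refl
χ-xor true  true  true  = refl

-- For an edge e = uv, the cuts of {u} and {v} share only e, and the symmetric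
-- difference of these cuts is the cut of {u , v}.
edgeSum-isolate : (G : Graph) (b : Bool) (y : E G → ℤ) (e : E G) →
  let (u , v) = Graph.ends G e in
  edgeSum G b y (star u) ℤ.+ edgeSum G b y (star v) ≡
  (edgeSum G b y (λ i → star u i xor star v i) ℤ.+ edgeSum G b y (λ _ → false)) ℤ.+ ±2 b ℤ.* y e
edgeSum-isolate G b y e = begin
  sum (λ e′ → χ (b xor cᵤ e′) ℤ.* y e′) ℤ.+ sum (λ e′ → χ (b xor cᵥ e′) ℤ.* y e′)
    ≡⟨ sym (∑-distrib-+ (λ e′ → χ (b xor cᵤ e′) ℤ.* y e′) (λ e′ → χ (b xor cᵥ e′) ℤ.* y e′)) ⟩
  sum (λ e′ → χ (b xor cᵤ e′) ℤ.* y e′ ℤ.+ χ (b xor cᵥ e′) ℤ.* y e′)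
    ≡⟨ sum-cong-≗ pointwise ⟩
  sum (λ e′ → (F e′ ℤ.+ F₀ e′) ℤ.+ (±2 b ℤ.* y e′) ℤ.* χ (does (e ≟ e′)))
    ≡⟨ ∑-distrib-+ (λ e′ → F e′ ℤ.+ F₀ e′) (λ e′ → (±2 b ℤ.* y e′) ℤ.* χ (does (e ≟ e′))) ⟩
  sum (λ e′ → F e′ ℤ.+ F₀ e′) ℤ.+ sum (λ e′ → (±2 b ℤ.* y e′) ℤ.* χ (does (e ≟ e′)))
    ≡⟨ cong₂ ℤ._+_ (∑-distrib-+ F F₀) (trans (if-select (λ e′ → ±2 b ℤ.* y e′) e 1ℤ) (ℤ.*-identityʳ _)) ⟩
  (sum F ℤ.+ sum F₀) ℤ.+ ±2 b ℤ.* y e ∎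
  where
  u = proj₁ (Graph.ends G e)
  v = proj₂ (Graph.ends G e)
  cᵤ = cutting G (star u)
  cᵥ = cutting G (star v)
  F F₀ : E G → ℤ
  F  e′ = χ (b xor cutting G (λ i → star u i xor star v i) e′) ℤ.* y e′
  -- The constant colouring cuts nothing, so its `edgeSum` unfolds to `sum F₀`.
  F₀ e′ = χ (b xor false) ℤ.* y e′

  -- Cuts are additive modulo 2: the sum of two colourings cuts the symmetric difference of their
  -- cuts.
  xor-interchange : ∀ i j i′ j′ → (i xor j) xor (i′ xor j′) ≡ (i xor i′) xor (j xor j′)
  xor-interchange = xor-∧-Solver.solve 4 (λ i j i′ j′ → ((i :+ j) :+ (i′ :+ j′)) := ((i :+ i′) :+ (j :+ j′))) refl
    where open xor-∧-Solver using (_:+_; _:=_)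

  expand : ∀ p q r w z y → p ℤ.+ q ≡ (r ℤ.+ w) ℤ.+ z → p ℤ.* y ℤ.+ q ℤ.* y ≡ (r ℤ.* y ℤ.+ w ℤ.* y) ℤ.+ z ℤ.* y
  expand p q r w z y eq = trans (sym (ℤ.*-distribʳ-+ y p q)) (trans (cong (ℤ._* y) eq) (distrib r w z y))
    where
    distrib : ∀ r w z y → ((r ℤ.+ w) ℤ.+ z) ℤ.* y ≡ (r ℤ.* y ℤ.+ w ℤ.* y) ℤ.+ z ℤ.* y
    distrib = solve-∀

  swap-factors : ∀ p q r → (p ℤ.* q) ℤ.* r ≡ (p ℤ.* r) ℤ.* q
  swap-factors = solve-∀

  pointwise : ∀ e′ → χ (b xor cᵤ e′) ℤ.* y e′ ℤ.+ χ (b xor cᵥ e′) ℤ.* y e′ ≡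
                     (F e′ ℤ.+ F₀ e′) ℤ.+ (±2 b ℤ.* y e′) ℤ.* χ (does (e ≟ e′))
  pointwise e′ = let (i , j) = Graph.ends G e′ in begin
    χ (b xor cᵤ e′) ℤ.* y e′ ℤ.+ χ (b xor cᵥ e′) ℤ.* y e′
      ≡⟨ expand (χ (b xor cᵤ e′)) (χ (b xor cᵥ e′)) (χ (b xor (cᵤ e′ xor cᵥ e′))) (χ (b xor false)) (±2 b ℤ.* χ (cᵤ e′ ∧ cᵥ e′)) (y e′) (χ-xor b (cᵤ e′) (cᵥ e′)) ⟩
    (χ (b xor (cᵤ e′ xor cᵥ e′)) ℤ.* y e′ ℤ.+ F₀ e′) ℤ.+ (±2 b ℤ.* χ (cᵤ e′ ∧ cᵥ e′)) ℤ.* y e′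
      ≡⟨ cong₂ (λ d x → (χ (b xor d) ℤ.* y e′ ℤ.+ F₀ e′) ℤ.+ (±2 b ℤ.* χ x) ℤ.* y e′)
               (xor-interchange (star u i) (star u j) (star v i) (star v j)) (cutting-star-∧ G e e′) ⟩
    (F e′ ℤ.+ F₀ e′) ℤ.+ (±2 b ℤ.* χ (does (e ≟ e′))) ℤ.* y e′
      ≡⟨ cong (λ z → (F e′ ℤ.+ F₀ e′) ℤ.+ z) (swap-factors (±2 b) (χ (does (e ≟ e′))) (y e′)) ⟩
    (F e′ ℤ.+ F₀ e′) ℤ.+ (±2 b ℤ.* y e′) ℤ.* χ (does (e ≟ e′)) ∎

-- The values on the four colourings of `edgeSum-isolate` determine `±2 b` times `y e`, and the
-- factor cancels.
edgeSum-injective : (G : Graph) (b : Bool) (y y′ : E G → ℤ) →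
                    (∀ c → edgeSum G b y c ≡ edgeSum G b y′ c) → y ≗ y′
edgeSum-injective G b y y′ eq e = cancel b (+-cancelˡ
  (edgeSum G b y (λ i → star u i xor star v i) ℤ.+ edgeSum G b y (λ _ → false)) _ _ (begin
    _ ≡⟨ sym (edgeSum-isolate G b y e) ⟩
    edgeSum G b y (star u) ℤ.+ edgeSum G b y (star v)    ≡⟨ cong₂ ℤ._+_ (eq (star u)) (eq (star v)) ⟩
    edgeSum G b y′ (star u) ℤ.+ edgeSum G b y′ (star v)  ≡⟨ edgeSum-isolate G b y′ e ⟩
    _ ≡⟨ cong (ℤ._+ ±2 b ℤ.* y′ e) (sym (cong₂ ℤ._+_ (eq (λ i → star u i xor star v i)) (eq (λ _ → false)))) ⟩
    _ ∎))
  where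
  u = proj₁ (Graph.ends G e)
  v = proj₂ (Graph.ends G e)
  -- Splitting on `b` turns `±2 b` into a literal, which is visibly nonzero.
  cancel : ∀ b {i j} → ±2 b ℤ.* i ≡ ±2 b ℤ.* j → i ≡ j
  cancel true  = ℤ.*-cancelˡ-≡ (±2 true) _ _
  cancel false = ℤ.*-cancelˡ-≡ (±2 false) _ _

-- Each label is carried by some edge, by surjectivity; the weights at that edge agree, and its
-- nonzero multiplicity cancels.
rows-independent : (G : LabelledGraph k) (b : Bool) (x x′ : Fin k → ℤ) →
  (∀ p → sum (λ a → x a ℤ.* 𝒜 G (row b a) p) ≡ sum (λ a → x′ a ℤ.* 𝒜 G (row b a) p)) → x ≗ x′
rows-independent G b x x′ eq a = let (e , le≡a) = surjective a in
  subst (λ a → x a ≡ x′ a) le≡a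
    (ℤ.*-cancelʳ-≡ _ _ (mult e) ⦃ ℤ.≢-nonZero (nonzero e) ⦄
      (edgeSum-injective (graph G) b (λ e → x (label e) ℤ.* mult e) (λ e → x′ (label e) ℤ.* mult e) edgeSums≡ e))
  where
  open LabelledGraph G using (label; mult; surjective; nonzero)
  edgeSums≡ : ∀ c → edgeSum (graph G) b (λ e → x (label e) ℤ.* mult e) c
                  ≡ edgeSum (graph G) b (λ e → x′ (label e) ℤ.* mult e) c
  edgeSums≡ c = begin
    _ ≡⟨ sym (edgeSum-cong (graph G) b _ (side-partition c)) ⟩
    _ ≡⟨ sym (combination-of-rows G b x (partition c)) ⟩
    _ ≡⟨ eq (partition c) ⟩
    _ ≡⟨ combination-of-rows G b x′ (partition c) ⟩
    _ ≡⟨ edgeSum-cong (graph G) b _ (side-partition c) ⟩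
    _ ∎

-- The zero blocks remove the mixed terms, so `s`-rows and `t`-rows can be compared separately.
⊗-blockDiagonal : ∀ {C : Set} {N : Matrix (Var k) (Var k′)} → BlockDiagonal N →
  (S : Matrix (Var k′) C) (b : Bool) (i : Fin k) (c : C) →
  (N ⊗ S) (row b i) c ≡ sum (λ a → N (row b i) (row b a) ℤ.* S (row b a) c)
⊗-blockDiagonal {N = N} (_ , _ , N≐) S false i c = trans
  (cong (λ z → sum (λ a → N (s i) (s a) ℤ.* S (s a) c) ℤ.+ z) (sum-zero _ λ a → trans (cong (ℤ._* S (t a) c) (N≐ (s i) (t a))) (ℤ.*-zeroˡ (S (t a) c))))
  (ℤ.+-identityʳ _)
⊗-blockDiagonal {N = N} (_ , _ , N≐) S true i c = trans
  (cong (ℤ._+ sum (λ a → N (t i) (t a) ℤ.* S (t a) c)) (sum-zero _ λ a → trans (cong (ℤ._* S (s a) c) (N≐ (t i) (s a))) (ℤ.*-zeroˡ (S (s a) c))))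
  (ℤ.+-identityˡ _)

row-elim : {P : Var k → Set} → (∀ b a → P (row b a)) → ∀ x → P x
row-elim P-row (s a) = P-row false a
row-elim P-row (t a) = P-row true a

block-row : (X : Matrix (Fin k) (Fin k′)) (b : Bool) → ∀ i j → block X X (row b i) (row b j) ≡ X i j
block-row X false i j = refl
block-row X true  i j = refl

-- The hypothesis compares weights edge by edge: combining the old rows with coefficients `X i` must
-- weigh every edge as the new row `i` does. These weights do not involve `b`, hence the same block
-- twice. Statements ii), iii) and iii.bis) are instances.
uniqueFactor : (G : Graph) (l : Labeling G k) (σ : Multiplicity G) (l′ : Labeling G k′) (σ′ : Multiplicity G)
  (X : Matrix (Fin k′) (Fin k)) →
  (∀ i e → X i (Labeling.label l e) ℤ.* Multiplicity.mult σ e ≡ coeff ⟨ G , l′ , σ′ ⟩ i e) →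
  IsUniqueFactor (𝒜 ⟨ G , l′ , σ′ ⟩) (𝒜 ⟨ G , l , σ ⟩) (block X X)
uniqueFactor {k} {k′} G l σ l′ σ′ X X≡ = (diagonal , factor) , unique
  where
  S = 𝒜 ⟨ G , l , σ ⟩
  T = 𝒜 ⟨ G , l′ , σ′ ⟩
  M = block X X

  diagonal : BlockDiagonal M
  diagonal = X , X , λ _ _ → refl

  factor : T ≐ M ⊗ S
  factor = row-elim λ b i p → begin
    T (row b i) p
      ≡⟨ 𝒜-row ⟨ G , l′ , σ′ ⟩ b i p ⟩
    edgeSum G b (coeff ⟨ G , l′ , σ′ ⟩ i) (side p)
      ≡⟨ sum-cong-≗ (λ e → cong (χ (b xor cutting G (side p) e) ℤ.*_) (sym (X≡ i e))) ⟩
    edgeSum G b (λ e → X i (Labeling.label l e) ℤ.* Multiplicity.mult σ e) (side p)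
      ≡⟨ sym (combination-of-rows ⟨ G , l , σ ⟩ b (X i) p) ⟩
    sum (λ a → X i a ℤ.* S (row b a) p)
      ≡⟨ sum-cong-≗ (λ a → cong (ℤ._* S (row b a) p) (sym (block-row X b i a))) ⟩
    sum (λ a → M (row b i) (row b a) ℤ.* S (row b a) p)
      ≡⟨ sym (⊗-blockDiagonal diagonal S b i p) ⟩
    (M ⊗ S) (row b i) p ∎

  unique : ∀ N → BlockDiagonal N → T ≐ N ⊗ S → N ≐ M
  unique N N-diagonal@(_ , _ , N≐) T≐ = λ where
      (s i) (s j) → on-diagonal false i j
      (s i) (t j) → N≐ (s i) (t j)
      (t i) (s j) → N≐ (t i) (s j)
      (t i) (t j) → on-diagonal true i j
    where
    on-diagonal : ∀ b i j → N (row b i) (row b j) ≡ M (row b i) (row b j)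
    -- Row `i` of either factor gives coefficients of the same vector with respect to independent
    -- rows.
    on-diagonal b i = rows-independent ⟨ G , l , σ ⟩ b (N (row b i) ∘ row b) (M (row b i) ∘ row b) λ p → begin
      _                      ≡⟨ sym (⊗-blockDiagonal N-diagonal S b i p) ⟩
      (N ⊗ S) (row b i) p    ≡⟨ sym (T≐ (row b i) p) ⟩
      T (row b i) p          ≡⟨ factor (row b i) p ⟩
      (M ⊗ S) (row b i) p    ≡⟨ ⊗-blockDiagonal diagonal S b i p ⟩
      _                      ∎

δ-mult : (i j : Fin k) (z : ℤ) → δ i j ℤ.* z ≡ (if does (j ≟ i) then z else 0ℤ)
δ-mult i j z = trans (sym (if-χ (does (i ≟ j)) z))
  (cong (if_then z else 0ℤ) (does-⇔ (mk⇔ sym sym) (i ≟ j) (j ≟ i)))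

-- Bijections between sets of partitions

-- Injectivity yields both the congruence of the section `from` and the second inverse law.
section⇒inverse : (S T : Setoid 0ℓ 0ℓ) (let module S = Setoid S) (let module T = Setoid T)
  (to : S.Carrier → T.Carrier) (from : T.Carrier → S.Carrier) →
  (∀ {x y} → x S.≈ y → to x T.≈ to y) → (∀ {x y} → to x T.≈ to y → x S.≈ y) →
  (∀ y → to (from y) T.≈ y) → Inverse S T
section⇒inverse S T to from cong inj to-from = record
  { to        = to
  ; from      = from
  ; to-cong   = cong
  ; from-cong = λ {x} {y} x≈y → inj (T.trans (to-from x) (T.trans x≈y (T.sym (to-from y))))
  ; inverse   = (λ {x} y≈ → T.trans (cong y≈) (to-from x)) , (λ {x} {y} y≈ → inj (T.trans (to-from y) y≈))
  }
  where
  module S = Setoid S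
  module T = Setoid T

∼-reindex : ∀ {m} (f : Fin m → Fin n) {c d : Colouring n} → c ∼ d → c ∘ f ∼ d ∘ f
∼-reindex f (b , eq) = b , eq ∘ f

-- The partition into preimages; along the inclusion of a subgraph, the restriction to its vertices.
pullback : ∀ {m} → (Fin m → Fin n) → Partition n → Partition m
pullback f p = partition (side p ∘ f)

pullback-≈ : ∀ {m} (f : Fin m → Fin n) {p q : Partition n} →
             side p ∘ f ∼ side q ∘ f → parts (pullback f p) ≈ᵤ parts (pullback f q)
pullback-≈ f {p} {q} (b , eq) = side-injective {p = pullback f p} {pullback f q}
  (b , λ i → trans (side-partition (side p ∘ f) i) (trans (eq i) (cong (b xor_) (sym (side-partition (side q ∘ f) i)))))

pullback-≈⁻ : ∀ {m} (f : Fin m → Fin n) {p q : Partition n} →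
              parts (pullback f p) ≈ᵤ parts (pullback f q) → side p ∘ f ∼ side q ∘ f
pullback-≈⁻ f {p} {q} p≈q = let (b , eq) = side-cong {p = pullback f p} {pullback f q} p≈q in
  b , λ i → trans (sym (side-partition (side p ∘ f) i)) (trans (eq i) (cong (b xor_) (side-partition (side q ∘ f) i)))

pullback-partition : ∀ {m} (f : Fin m → Fin n) (c : Colouring n) (q : Partition m) →
                     c ∘ f ∼ side q → parts (pullback f (partition c)) ≈ᵤ parts q
pullback-partition f c q (b , eq) = side-injective {p = pullback f (partition c)} {q}
  (b , λ i → trans (side-partition _ i) (trans (side-partition c (f i)) (eq i)))

renaming-inverse : (G : Graph) (π : Permutation′ (suc (Graph.n G))) → Inverse (Π G) (Π (rename G π))
renaming-inverse G π = section⇒inverse (Π G) (Π (rename G π))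
  -- The image of a partition under `π` is its pullback along the inverse of `π`.
  (pullback (π ⟨$⟩ˡ_)) (pullback (π ⟨$⟩ʳ_))
  (λ {p} {q} p≈q → pullback-≈ (π ⟨$⟩ˡ_) {p} {q} (∼-reindex (π ⟨$⟩ˡ_) (side-cong {p = p} {q} p≈q)))
  (λ {p} {q} p≈q → let (b , eq) = pullback-≈⁻ (π ⟨$⟩ˡ_) {p} {q} p≈q in
     side-injective {p = p} {q} (b , λ i → subst (λ j → side p j ≡ b xor side q j) (inverseˡ π) (eq (π ⟨$⟩ʳ i))))
  (λ q → pullback-partition (π ⟨$⟩ˡ_) (side q ∘ (π ⟨$⟩ʳ_)) q (false , λ i → cong (side q) (inverseʳ π)))

rowSum-rename : (G : Graph) (π : Permutation′ (suc (Graph.n G))) (b : Bool) (a : E G) (p : ∣Π G ∣) →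
  rowSum (classical (rename G π)) b a (side (pullback (π ⟨$⟩ˡ_) p)) ≡ rowSum (classical G) b a (side p)
rowSum-rename G π b a p = sum-cong-≗ λ e → cong (λ z → χ (b xor z) ℤ.* coeff (classical G) a e)
  (cong₂ _xor_ (side-π _) (side-π _))
  where
  side-π : ∀ i → side (pullback (π ⟨$⟩ˡ_) p) (π ⟨$⟩ʳ i) ≡ side p i
  side-π i = trans (side-partition (side p ∘ (π ⟨$⟩ˡ_)) (π ⟨$⟩ʳ i)) (cong (side p) (inverseˡ π))

-- Unions

-- The rows of a union are sorted first into `s` and `t`, those of `_#_` first by graph.
varSplit : ∀ k h → Var (k + h) ↔ (Var k ⊎ Var h)
varSplit k h = mk↔ₛ′ to from to-from from-to
  where
  to : Var (k + h) → Var k ⊎ Var h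
  to (s x) = Sum.map inj₁ inj₁ (splitAt k x)
  to (t x) = Sum.map inj₂ inj₂ (splitAt k x)

  from : Var k ⊎ Var h → Var (k + h)
  from (inj₁ (s a)) = s (a ↑ˡ h)
  from (inj₁ (t a)) = t (a ↑ˡ h)
  from (inj₂ (s a)) = s (k ↑ʳ a)
  from (inj₂ (t a)) = t (k ↑ʳ a)

  to-from : ∀ y → to (from y) ≡ y
  to-from (inj₁ (s a)) = cong (Sum.map inj₁ inj₁) (splitAt-↑ˡ k a h)
  to-from (inj₁ (t a)) = cong (Sum.map inj₂ inj₂) (splitAt-↑ˡ k a h)
  to-from (inj₂ (s a)) = cong (Sum.map inj₁ inj₁) (splitAt-↑ʳ k h a)
  to-from (inj₂ (t a)) = cong (Sum.map inj₂ inj₂) (splitAt-↑ʳ k h a)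

  from-to : ∀ x → from (to x) ≡ x
  from-to (s x) with splitAt k x in eq
  ... | inj₁ _ = cong inj₁ (splitAt⁻¹-↑ˡ eq)
  ... | inj₂ _ = cong inj₁ (splitAt⁻¹-↑ʳ eq)
  from-to (t x) with splitAt k x in eq
  ... | inj₁ _ = cong inj₂ (splitAt⁻¹-↑ˡ eq)
  ... | inj₂ _ = cong inj₂ (splitAt⁻¹-↑ʳ eq)

to-varSplit : ∀ k h (b : Bool) (x : Fin (k + h)) →
              Inverse.to (varSplit k h) (row b x) ≡ Sum.map (row b) (row b) (splitAt k x)
to-varSplit k h false x = refl
to-varSplit k h true  x = refl

module _ (G : LabelledGraph k) (H : LabelledGraph h) {N : ℕ}
         (f : V (graph G) → Fin (suc N)) (g : V (graph H) → Fin (suc N))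
         (f-inj : Injective _≡_ _≡_ f) (g-inj : Injective _≡_ _≡_ g)
         (meet : ∀ {x x′ y y′} → f x ≡ g y → f x′ ≡ g y′ → x ≡ x′) where

  private
    module G = LabelledGraph G
    module H = LabelledGraph H
    open Union G H f g f-inj g-inj meet using (union)

    term : Bool → Fin (k + h) → Colouring (suc N) → E (graph union) → ℤ
    term b a c e = χ (b xor cutting (graph union) c e) ℤ.* coeff union a e

    -- Ends, label and multiplicity of an edge of the union all depend on one `splitAt`. As
    -- parameters they can be replaced together once the side is known.
    summand : Bool → Fin (k + h) → Colouring (suc N) → Fin (suc N) × Fin (suc N) → Fin (k + h) → ℤ → ℤ
    summand b a c (i , j) l z = χ (b xor (c i xor c j)) ℤ.* (if does (l ≟ a) then z else 0ℤ)

    term-↑ˡ : ∀ b a c e → term b a c (e ↑ˡ H.m) ≡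
      summand b a c (Product.map f f (G.ends e)) (G.label e ↑ˡ h) (G.mult e)
    term-↑ˡ b a c e rewrite splitAt-↑ˡ G.m e H.m = refl

    term-↑ʳ : ∀ b a c e → term b a c (G.m ↑ʳ e) ≡
      summand b a c (Product.map g g (H.ends e)) (k ↑ʳ H.label e) (H.mult e)
    term-↑ʳ b a c e rewrite splitAt-↑ʳ G.m H.m e = refl

    summand-off : ∀ b a c ij {l} z → l ≢ a → summand b a c ij l z ≡ 0ℤ
    summand-off b a c (i , j) {l} z l≢a = trans
      (cong (λ d → χ (b xor (c i xor c j)) ℤ.* (if d then z else 0ℤ)) (dec-false (l ≟ a) l≢a))
      (ℤ.*-zeroʳ (χ (b xor (c i xor c j))))

  -- Edges of `H` carry labels from the other summand and drop out; edges of `G` see the colouring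
  -- only through `f`.
  rowSum-unionˡ : ∀ b a c → rowSum union b (a ↑ˡ h) c ≡ rowSum G b a (c ∘ f)
  rowSum-unionˡ b a c = trans (sum-++ G.m (term b (a ↑ˡ h) c)) (trans
    (cong₂ ℤ._+_
      (sum-cong-≗ λ e → trans (term-↑ˡ b (a ↑ˡ h) c e)
        (cong (λ d → χ (b xor cutting (graph G) (c ∘ f) e) ℤ.* (if d then G.mult e else 0ℤ))
              (does-⇔ (mk⇔ (↑ˡ-injective h _ _) (cong (_↑ˡ h))) (G.label e ↑ˡ h ≟ a ↑ˡ h) (G.label e ≟ a))))
      (sum-zero (term b (a ↑ˡ h) c ∘ (G.m ↑ʳ_)) λ e → trans (term-↑ʳ b (a ↑ˡ h) c e)
        (summand-off b (a ↑ˡ h) c _ (H.mult e) (↑ˡ≢↑ʳ a (H.label e) ∘ sym))))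
    (ℤ.+-identityʳ _))

  rowSum-unionʳ : ∀ b a c → rowSum union b (k ↑ʳ a) c ≡ rowSum H b a (c ∘ g)
  rowSum-unionʳ b a c = trans (sum-++ G.m (term b (k ↑ʳ a) c)) (trans
    (cong₂ ℤ._+_
      (sum-zero (term b (k ↑ʳ a) c ∘ (_↑ˡ H.m)) λ e → trans (term-↑ˡ b (k ↑ʳ a) c e)
        (summand-off b (k ↑ʳ a) c _ (G.mult e) (↑ˡ≢↑ʳ (G.label e) a)))
      (sum-cong-≗ λ e → trans (term-↑ʳ b (k ↑ʳ a) c e)
        (cong (λ d → χ (b xor cutting (graph H) (c ∘ g) e) ℤ.* (if d then H.mult e else 0ℤ))
              (does-⇔ (mk⇔ (↑ʳ-injective k _ _) (cong (k ↑ʳ_))) (k ↑ʳ H.label e ≟ k ↑ʳ a) (H.label e ≟ a)))))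
    (ℤ.+-identityˡ _))

  𝒜-union : ∀ x p → 𝒜 union x p ≡ (𝒜 G # 𝒜 H) (Inverse.to (varSplit k h) x) (pullback f p , pullback g p)
  𝒜-union = row-elim λ b x p → trans (𝒜-row union b x p) (trans (split b x p)
      (sym (cong (λ r → (𝒜 G # 𝒜 H) r (pullback f p , pullback g p)) (to-varSplit k h b x))))
    where
    split : ∀ b x p → rowSum union b x (side p) ≡
            (𝒜 G # 𝒜 H) (Sum.map (row b) (row b) (splitAt k x)) (pullback f p , pullback g p)
    split b x p with splitAt k x in eq
    ... | inj₁ a = begin
      rowSum union b x (side p)          ≡⟨ cong (λ x → rowSum union b x (side p)) (sym (splitAt⁻¹-↑ˡ eq)) ⟩
      rowSum union b (a ↑ˡ h) (side p)   ≡⟨ rowSum-unionˡ b a (side p) ⟩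
      rowSum G b a (side p ∘ f)          ≡⟨ sym (edgeSum-cong (graph G) b (coeff G a) (side-partition (side p ∘ f))) ⟩
      rowSum G b a (side (pullback f p)) ≡⟨ sym (𝒜-row G b a (pullback f p)) ⟩
      𝒜 G (row b a) (pullback f p)       ∎
    ... | inj₂ a = begin
      rowSum union b x (side p)          ≡⟨ cong (λ x → rowSum union b x (side p)) (sym (splitAt⁻¹-↑ʳ eq)) ⟩
      rowSum union b (k ↑ʳ a) (side p)   ≡⟨ rowSum-unionʳ b a (side p) ⟩
      rowSum H b a (side p ∘ g)          ≡⟨ sym (edgeSum-cong (graph H) b (coeff H a) (side-partition (side p ∘ g))) ⟩
      rowSum H b a (side (pullback g p)) ≡⟨ sym (𝒜-row H b a (pullback g p)) ⟩
      𝒜 H (row b a) (pullback g p)       ∎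

-- Gluing colourings

offset-injective : ∀ b b′ x y → (b xor x) xor (b′ xor y) ≡ x xor y → b ≡ b′
offset-injective false false _ _ _ = refl
offset-injective true  true  _ _ _ = refl
offset-injective false true  false false ()
offset-injective false true  false true  ()
offset-injective false true  true  false ()
offset-injective false true  true  true  ()
offset-injective true  false false false ()
offset-injective true  false false true  ()
offset-injective true  false true  false ()
offset-injective true  false true  true  ()

-- The relative colour of f x and g y forces the flips on the two halves to agree.
∼-glue : ∀ {m m′} (f : Fin m → Fin n) (g : Fin m′ → Fin n) (x : Fin m) (y : Fin m′) {c d : Colouring n} →
  (∀ w → (∃ λ i → f i ≡ w) ⊎ (∃ λ j → g j ≡ w)) →
  c ∘ f ∼ d ∘ f → c ∘ g ∼ d ∘ g → c (f x) xor c (g y) ≡ d (f x) xor d (g y) → c ∼ d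
∼-glue f g x y {c} {d} cover (b , eq) (b′ , eq′) rel = b , at
  where
  b≡b′ : b ≡ b′
  b≡b′ = offset-injective b b′ (d (f x)) (d (g y)) (trans (sym (cong₂ _xor_ (eq x) (eq′ y))) rel)
  at : ∀ w → c w ≡ b xor d w
  at w with cover w
  ... | inj₁ (i , refl) = eq i
  ... | inj₂ (j , refl) = trans (eq′ j) (cong (_xor d (g j)) (sym b≡b′))

cancel-offset : ∀ b x y → x xor ((b xor (x xor y)) xor y) ≡ b
cancel-offset = xor-∧-Solver.solve 3 (λ b x y → x :+ ((b :+ (x :+ y)) :+ y) := b) refl
  where open xor-∧-Solver using (_:+_; _:=_)

xor-cancel : ∀ b x y → (b xor x) xor (b xor y) ≡ x xor y
xor-cancel = xor-∧-Solver.solve 3 (λ b x y → (b :+ x) :+ (b :+ y) := x :+ y) refl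
  where open xor-∧-Solver using (_:+_; _:=_)

relative-cong : {c d : Colouring n} → c ∼ d → ∀ i j → c i xor c j ≡ d i xor d j
relative-cong (b , eq) i j = trans (cong₂ _xor_ (eq i) (eq j)) (xor-cancel b _ _)

module _ (G : LabelledGraph k) (H : LabelledGraph h) where

  private
    module G = LabelledGraph G
    module H = LabelledGraph H

  -- Disjoint unions

  module _ where
    private
      f : V (graph G) → Fin (suc G.n + suc H.n)
      f = _↑ˡ suc H.n

      g : V (graph H) → Fin (suc G.n + suc H.n)
      g = suc G.n ↑ʳ_

      cover : ∀ w → (∃ λ i → f i ≡ w) ⊎ (∃ λ j → g j ≡ w)
      cover w with splitAt (suc G.n) w in eq
      ... | inj₁ i = inj₁ (i , splitAt⁻¹-↑ˡ eq)
      ... | inj₂ j = inj₂ (j , splitAt⁻¹-↑ʳ eq)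

      -- This flip-invariant bit tells apart the two copies of a column. Vertex sets are nonempty,
      -- so `zero` serves as a base vertex on each side.
      relative : Partition (suc G.n + suc H.n) → Bool
      relative p = side p (f zero) xor side p (g zero)

      glue : Colouring (suc G.n) → Colouring (suc H.n) → Colouring (suc G.n + suc H.n)
      glue c d w = [ c , d ]′ (splitAt (suc G.n) w)

      glue-f : ∀ c d i → glue c d (f i) ≡ c i
      glue-f c d i = cong [ c , d ]′ (splitAt-↑ˡ (suc G.n) i (suc H.n))

      glue-g : ∀ c d j → glue c d (g j) ≡ d j
      glue-g c d j = cong [ c , d ]′ (splitAt-↑ʳ (suc G.n) (suc H.n) j)

      -- The flip of the half on `H` for which the base vertices get relative colour `b`.
      offset : Partition (suc G.n) → Partition (suc H.n) → Bool → Bool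
      offset q r b = b xor (side q zero xor side r zero)

      glued : Partition (suc G.n) → Partition (suc H.n) → Bool → Colouring (suc G.n + suc H.n)
      glued q r b = glue (side q) (λ j → offset q r b xor side r j)

    disjointUnion-inverse : Inverse (Π (graph (G ⊔ H))) ((Π (graph G) ×ₛ Π (graph H)) ×ₛ setoid Bool)
    disjointUnion-inverse = section⇒inverse _ _
      (λ p → (pullback f p , pullback g p) , relative p)
      (λ ((q , r) , b) → partition (glued q r b))
      (λ {p} {p′} p≈ → let ∼ = side-cong {p = p} {p′} p≈ in
        ( pullback-≈ f {p} {p′} (∼-reindex f ∼) , pullback-≈ g {p} {p′} (∼-reindex g ∼))
        , relative-cong ∼ (f zero) (g zero))
      (λ {p} {p′} ((q≈ , r≈) , rel) → side-injective {p = p} {p′}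
        (∼-glue f g zero zero cover (pullback-≈⁻ f {p} {p′} q≈) (pullback-≈⁻ g {p} {p′} r≈) rel))
      (λ ((q , r) , b) →
        ( pullback-partition f (glued q r b) q (false , glue-f _ _)
        -- The restriction to `H` is `side r` flipped by the offset, the same unordered partition.
        , pullback-partition g (glued q r b) r (offset q r b , glue-g _ _))
        , (begin
            side (partition (glued q r b)) (f zero) xor side (partition (glued q r b)) (g zero)
              ≡⟨ cong₂ _xor_ (side-partition (glued q r b) (f zero)) (side-partition (glued q r b) (g zero)) ⟩
            glued q r b (f zero) xor glued q r b (g zero)
              ≡⟨ cong₂ _xor_ (glue-f (side q) (λ j → offset q r b xor side r j) zero) (glue-g (side q) (λ j → offset q r b xor side r j) zero) ⟩
            side q zero xor (offset q r b xor side r zero)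
              ≡⟨ cancel-offset b (side q zero) (side r zero) ⟩
            b ∎))

    𝒜-⊔ : ∀ x p → 𝒜 (G ⊔ H) x p ≡
           twice (𝒜 G # 𝒜 H) (Inverse.to (varSplit k h) x) (Inverse.to disjointUnion-inverse p)
    𝒜-⊔ = 𝒜-union G H f g (↑ˡ-injective _ _ _) (↑ʳ-injective (suc G.n) _ _)
      (λ {x} {_} {y} eq _ → contradiction eq (↑ˡ≢↑ʳ x y))

  -- Clique 0-sums

  module _ (u : V (graph G)) (v : V (graph H)) where
    open ZeroSum G H u v using (fromG; fromH; fromG-injective; fromH-injective; common)

    fromH-v : fromH v ≡ fromG u
    fromH-v with v ≟ v
    ... | yes _  = refl
    ... | no v≢v = contradiction refl v≢v

    fromH-punchIn : ∀ j → fromH (punchIn v j) ≡ suc G.n ↑ʳ j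
    fromH-punchIn j with v ≟ punchIn v j
    ... | yes v≡ = contradiction (sym v≡) (punchInᵢ≢i v j)
    ... | no v≢  = cong (suc G.n ↑ʳ_) (punchOut-punchIn v)

    private
      cover : ∀ w → (∃ λ i → fromG i ≡ w) ⊎ (∃ λ j → fromH j ≡ w)
      cover w with splitAt (suc G.n) w in eq
      ... | inj₁ i = inj₁ (i , splitAt⁻¹-↑ˡ eq)
      ... | inj₂ j = inj₂ (punchIn v j , trans (fromH-punchIn j) (splitAt⁻¹-↑ʳ eq))

      -- The common vertex takes its colour from `c`, so `d` is recovered only if `c u ≡ d v`.
      glue : Colouring (suc G.n) → Colouring (suc H.n) → Colouring (suc (G.n + H.n))
      glue c d w = [ c , d ∘ punchIn v ]′ (splitAt (suc G.n) w)

      glue-fromG : ∀ c d i → glue c d (fromG i) ≡ c i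
      glue-fromG c d i = cong [ c , d ∘ punchIn v ]′ (splitAt-↑ˡ (suc G.n) i H.n)

      glue-fromH : ∀ c d → c u ≡ d v → ∀ j → glue c d (fromH j) ≡ d j
      glue-fromH c d cu≡dv j with v ≟ j
      ... | yes refl = trans (glue-fromG c d u) cu≡dv
      ... | no v≢j   = trans (cong [ c , d ∘ punchIn v ]′ (splitAt-↑ʳ (suc G.n) H.n (punchOut v≢j)))
                             (cong d (punchIn-punchOut v≢j))

      -- The flip of `r` that makes the two colours of the common vertex agree.
      offset : Partition (suc G.n) → Partition (suc H.n) → Bool
      offset q r = side q u xor side r v

      glued : Partition (suc G.n) → Partition (suc H.n) → Colouring (suc (G.n + H.n))
      glued q r = glue (side q) (λ j → offset q r xor side r j)

      agree : ∀ x y → x ≡ (x xor y) xor y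
      agree = xor-∧-Solver.solve 2 (λ x y → x := (x :+ y) :+ y) refl
        where open xor-∧-Solver using (_:+_; _:=_)

      -- Both arguments are the identified vertex, so no bit remains free and columns are not
      -- doubled.
      relative : (c : Colouring (suc (G.n + H.n))) → c (fromG u) xor c (fromH v) ≡ false
      relative c = trans (cong (λ w → c (fromG u) xor c w) fromH-v) (xor-same (c (fromG u)))

    zeroSum-inverse : Inverse (Π (graph (zeroSum G H u v))) (Π (graph G) ×ₛ Π (graph H))
    zeroSum-inverse = section⇒inverse _ _
      (λ p → pullback fromG p , pullback fromH p)
      (λ (q , r) → partition (glued q r))
      (λ {p} {p′} p≈ → let ∼ = side-cong {p = p} {p′} p≈ in
        pullback-≈ fromG {p} {p′} (∼-reindex fromG ∼) , pullback-≈ fromH {p} {p′} (∼-reindex fromH ∼))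
      (λ {p} {p′} (q≈ , r≈) → side-injective {p = p} {p′}
        (∼-glue fromG fromH u v cover (pullback-≈⁻ fromG {p} {p′} q≈) (pullback-≈⁻ fromH {p} {p′} r≈)
          (trans (relative (side p)) (sym (relative (side p′))))))
      (λ (q , r) →
        pullback-partition fromG (glued q r) q (false , glue-fromG (side q) (λ j → offset q r xor side r j))
        , pullback-partition fromH (glued q r) r (offset q r , glue-fromH (side q) (λ j → offset q r xor side r j) (agree (side q u) (side r v))))

    𝒜-zeroSum : ∀ x p → 𝒜 (zeroSum G H u v) x p ≡
                (𝒜 G # 𝒜 H) (Inverse.to (varSplit k h) x) (Inverse.to zeroSum-inverse p)
    𝒜-zeroSum = 𝒜-union G H fromG fromH fromG-injective fromH-injective
      (λ {x} {x′} {y} {y′} eq eq′ → trans (common x y eq) (sym (common x′ y′ eq′)))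

lemma3p1 :
  ((G : Graph) (k : ℕ) (σ : Multiplicity G) (l : Labeling G k) →
    -- i)
    ((π : Permutation′ (suc (Graph.n G))) →
      Σ (Inverse (Π G) (Π (rename G π))) λ τ →
      ∀ x p → 𝒜 (classical (rename G π)) x (Inverse.to τ p) ≡ 𝒜 (classical G) x p)
    ×
    -- ii)
    (let Iσ = diag (Multiplicity.mult σ) in
      IsUniqueFactor (𝒜 ⟨ G , canonical G , σ ⟩) (𝒜 (classical G)) (block Iσ Iσ))
    ×
    -- iii)
    (let Bl = indicator (Labeling.label l) in
      IsUniqueFactor (𝒜 ⟨ G , l , trivial G ⟩) (𝒜 (classical G)) (block Bl Bl)))
  ×
  -- iii.bis)
  ((k : ℕ) (G : LabelledGraph (suc k)) (c : Fin k) →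
    let l′ = mergeLast c (labeling G)
        Bl′ = indicator (merge c) in
    IsUniqueFactor (𝒜 ⟨ graph G , l′ , multiplicity G ⟩) (𝒜 G) (block Bl′ Bl′))
  ×
  ((k h : ℕ) (G : LabelledGraph k) (H : LabelledGraph h) →
    -- iv)
    SameUpToOrder (Var (k + h)) (Var k ⊎ Var h)
      (Π (graph (G ⊔ H))) ((Π (graph G) ×ₛ Π (graph H)) ×ₛ setoid Bool)
      (𝒜 (G ⊔ H)) (twice (𝒜 G # 𝒜 H))
    ×
    -- v)
    ((u : V (graph G)) (v : V (graph H)) →
      SameUpToOrder (Var (k + h)) (Var k ⊎ Var h)
        (Π (graph (zeroSum G H u v))) (Π (graph G) ×ₛ Π (graph H))
        (𝒜 (zeroSum G H u v)) (𝒜 G # 𝒜 H)))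
lemma3p1 =
    (λ G k σ l →
        (λ π → renaming-inverse G π , row-elim λ b a p →
          trans (𝒜-row (classical (rename G π)) b a (pullback (π ⟨$⟩ˡ_) p))
                (trans (rowSum-rename G π b a p) (sym (𝒜-row (classical G) b a p))))
      , uniqueFactor G (canonical G) (trivial G) (canonical G) σ (diag (Multiplicity.mult σ)) (diag-coeff σ)
      , uniqueFactor G (canonical G) (trivial G) l (trivial G) (indicator (Labeling.label l))
          (λ i e → δ-mult i (Labeling.label l e) 1ℤ))
  , (λ k G c → uniqueFactor (graph G) (labeling G) (multiplicity G) (mergeLast c (labeling G)) (multiplicity G)
      (indicator (merge c)) (λ i e → δ-mult i (merge c (LabelledGraph.label G e)) (LabelledGraph.mult G e)))
  , (λ k h G H →
        (varSplit k h , disjointUnion-inverse G H , 𝒜-⊔ G H)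
      , (λ u v → varSplit k h , zeroSum-inverse G H u v , 𝒜-zeroSum G H u v))
  where
  diag-coeff : ∀ {G} (σ : Multiplicity G) i e →
               diag (Multiplicity.mult σ) i e ℤ.* 1ℤ ≡ coeff ⟨ G , canonical G , σ ⟩ i e
  diag-coeff σ i e with e ≟ i | i ≟ e
  ... | yes refl | yes _   = trans (ℤ.*-identityʳ _) (ℤ.*-identityʳ _)
  ... | no _     | no _    = trans (ℤ.*-identityʳ _) (ℤ.*-zeroʳ (Multiplicity.mult σ i))
  -- `diag` and `coeff` test the same equality in opposite directions, so the mixed cases must be
  -- refuted.
  ... | yes e≡i  | no i≢e  = contradiction (sym e≡i) i≢e
  ... | no e≢i   | yes i≡e = contradiction (sym i≡e) e≢i
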